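{- Let $r\ge 3$ and $t>1$ be integers. Then $\mathrm{ex}_r(n,F(t,r))=t\binom{n}{r-1}+O(n^{r-2})$ as $n\to\infty$ (with $r,t$ fixed).
   Context: $\mathcal{K}_r^{(r-1)}$ denotes the complete $(r-1)$-uniform hypergraph on $r$ vertices. Consider the $(r-1)$-graph on $t(r-1)+1$ vertices consisting of $t$ copies of $\mathcal{K}_r^{(r-1)}$ which pairwise intersect in exactly one common vertex. $F(t,r)$ is the $r$-graph obtained from it by adding a new vertex to each of its $tr$ hyperedges, where these $tr$ new vertices are distinct from each other and not among the original vertices. $\mathrm{ex}_r(n,\mathcal{F})$ is the maximum number of hyperedges in an $n$-vertex $r$-uniform hypergraph not containing $\mathcal{F}$ as a subhypergraph. -}

module Defs where

open import Data.Nat using (ℕ; zero; suc; _+_; _*_; _^_; _≤_; _∸_)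
open import Data.Nat.Combinatorics using (_C_)
open import Data.Fin using (Fin; zero; suc)
open import Data.Fin.Subset using (Subset; _∈_; ∣_∣)
open import Data.List using (List; length)
open import Data.List.Relation.Unary.All using (All)
open import Data.List.Relation.Unary.Unique.Propositional using (Unique)
import Data.List.Membership.Propositional as LM
open import Data.Product using (Σ; ∃; ∃-syntax; _×_; _,_)
open import Data.Sum using (_⊎_)
open import Relation.Binary.PropositionalEquality using (_≡_; _≢_)
open import Function.Definitions using (Injective)
open import Function.Bundles using (_⇔_)

record Hypergraph (r n : ℕ) : Set where
  field
    edges   : List (Subset n)
    unique  : Unique edges
    uniform : All (λ e → ∣ e ∣ ≡ r) edges

open Hypergraph public

numEdges : ∀ {r n} → Hypergraph r n → ℕ
numEdges H = length (edges H)

-- Vertices of F(t, k+1) (r = k+1):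
--   center        : the common vertex of the t copies of K_r^(r-1)
--   core i a      : the a-th non-central vertex of copy i (a : Fin k)
--   pend i j      : the new vertex added to hyperedge j of copy i (j : Fin r)
data FVert (t k : ℕ) : Set where
  center : FVert t k
  core   : Fin t → Fin k → FVert t k
  pend   : Fin t → Fin (suc k) → FVert t k

copyVert : ∀ {t k} → Fin t → Fin (suc k) → FVert t k
copyVert i zero    = center
copyVert i (suc a) = core i a

-- Membership in hyperedge (i , j) of F(t,r): the (r-1)-edge of copy i
-- omitting copy-vertex j, together with the new vertex pend i j.
InFEdge : ∀ {t k} → Fin t → Fin (suc k) → FVert t k → Set
InFEdge {t} {k} i j v =
  (v ≡ pend i j) ⊎ (∃[ a ] (a ≢ j × v ≡ copyVert i a))

ContainsF : ∀ {n} (t k : ℕ) → Hypergraph (suc k) n → Set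
ContainsF {n} t k H =
  Σ (FVert t k → Fin n) λ f →
    Injective _≡_ _≡_ f ×
    ((i : Fin t) (j : Fin (suc k)) →
      ∃[ e ] (e LM.∈ edges H ×
              ((x : Fin n) → (x ∈ e) ⇔ (∃[ v ] (InFEdge i j v × f v ≡ x)))))

{-# OPTIONS --safe #-}
-- Lower bound: take all r-sets meeting a fixed t-set T in exactly one vertex.  In a copy of
-- F(t,r), either the center lies in T, and then so does the pendant of each edge avoiding the
-- center, or every copy of K_r^(r-1) has a vertex in T and some copy has two.  Both need t + 1
-- vertices in T.
--
-- Upper bound: with d(L) the codegree of an (r-1)-set L, weigh an edge e by
-- W(e) = Σ_{L ⊂ e} 1/d(L).  Double counting gives Σ_e W(e) ≤ C(n,r-1), so at most t C(n,r-1)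
-- edges have W(e) ≥ 1/t; the others are good.  If t good edges meet pairwise in a single vertex v
-- only, the total weight Σ 1/d(L) of their tr facets is below 1, hence among any l of these
-- facets some L has d(L) > l, and distinct pendants for all of them can be chosen greedily.
-- It remains to see that more than c n^(r-2) good edges contain such a star (with the pendants
-- also off the star).  Otherwise each vertex v has a bounded set X(v) ∌ v met by every good edge
-- through v.  A good edge e is then closed under a fixed-point-free choice of v ↦ X(v) ∩ e, and
-- as r ≥ 3 two of its vertices can be recovered, up to boundedly many choices, from the other
-- r - 2.
module Submission where

open import Defs
open import Data.Nat using (ℕ; zero; suc; _+_; _*_; _^_; _≤_; _<_; _∸_; z≤n; s≤s; _≤?_; _<?_; _!; _/_; >-nonZero)
open import Data.Nat.Properties
open import Data.Nat.Combinatorics using (_C_; nCk+nC[k+1]≡[n+1]C[k+1]; nCk≡nC[n∸k]; nCn≡1)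
open import Data.Nat.Divisibility using (∣-trans; m∣m*n; m≤n⇒m!∣n!)
open import Data.Nat.DivMod using (m/n*n≡m; m/n*n≤m)
open import Data.Nat.ListAction using (sum)
open import Data.Nat.ListAction.Properties using (sum-++)
open import Data.Nat.Solver using (module +-*-Solver)
open import Algebra.Properties.CommutativeSemigroup +-commutativeSemigroup using (x∙yz≈y∙xz)
open import Data.Bool.Properties using () renaming (_≟_ to _≟ᵇ_)
open import Data.Fin using (Fin; zero; suc; _↑ˡ_; fromℕ<)
import Data.Fin.Properties as Fin
open import Data.Fin.Subset using (Subset; inside; outside; _∈_; _∉_; _∪_; _-_; ⁅_⁆; ∣_∣; ⋃)
open import Data.Fin.Subset.Properties
open import Data.List using (List; []; _∷_; _++_; length; map; concatMap; filter; allFin; lookup; take; cartesianProductWith)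
open import Data.List.Properties using (length-map; length-++; length-++-sucʳ; map-++; length-tabulate; filter-all; length-filter; take-all; length-take)
open import Data.List.Membership.Propositional using (lose; find) renaming (_∈_ to _∈ₗ_; _∉_ to _∉ₗ_)
import Data.List.Membership.DecPropositional as DecMembership
open import Data.List.Membership.Propositional.Properties using (∈-map⁺; ∈-map⁻; ∈-++⁺ˡ; ∈-++⁺ʳ; ∈-++⁻; ∈-∃++; ∈-filter⁺; ∈-filter⁻; ∈-concatMap⁺; ∈-concatMap⁻; ∈-cartesianProductWith⁻; ∈-allFin; ∈-lookup; ∈-length)
open import Data.List.Relation.Unary.All as All using (All; []; _∷_)
open import Data.List.Relation.Unary.All.Properties using (¬Any⇒All¬) renaming (map⁺ to All-map⁺; ++⁺ to All-++⁺; filter⁺ to All-filter⁺; all-filter to All-filter; take⁺ to All-take⁺)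
open import Data.List.Relation.Unary.AllPairs as AllPairs using (AllPairs; []; _∷_)
open import Data.List.Relation.Unary.AllPairs.Properties using () renaming (map⁺ to AllPairs-map⁺; filter⁺ to AllPairs-filter⁺)
open import Data.List.Relation.Unary.Any using (here; there; any?; index)
open import Data.List.Relation.Unary.Any.Properties using (lookup-index)
open import Data.List.Relation.Unary.Unique.Propositional using (Unique)
open import Data.List.Relation.Unary.Unique.Propositional.Properties using (allFin⁺) renaming (map⁺ to Unique-map⁺; ++⁺ to Unique-++⁺; concat⁺ to Unique-concat⁺; filter⁺ to Unique-filter⁺; take⁺ to Unique-take⁺; cartesianProductWith⁺ to Unique-cartesianProductWith⁺)
open import Data.Product using (Σ; ∃; ∃-syntax; _×_; _,_; proj₁; proj₂)
open import Data.Product.Properties using () renaming (≡-dec to ×-≡-dec)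
open import Data.Sum using (_⊎_; inj₁; inj₂; [_,_]′)
open import Data.Vec using ([]; _∷_; here; there) renaming (_++_ to _++ᵛ_)
open import Data.Vec.Properties using (∷-injectiveʳ; ++-injective) renaming (≡-dec to Vec-≡-dec)
open import Function using (_∘_)
open import Function.Bundles using (mk⇔; Equivalence)
open import Function.Definitions using (Injective)
open import Relation.Binary using (DecidableEquality; Symmetric)
open import Relation.Binary.PropositionalEquality using (_≡_; _≢_; refl; sym; trans; cong; cong₂; subst; module ≡-Reasoning)
open import Relation.Nullary using (¬_; Dec; yes; no; contradiction)
open import Relation.Nullary.Decidable using (¬?; _×-dec_)
open import Relation.Unary using (Decidable)

-- Finite sums over lists

∑ : {A : Set} → List A → (A → ℕ) → ℕ
∑ xs f = sum (map f xs)

module _ {A : Set} where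

  ∑-++ : ∀ xs {ys} (f : A → ℕ) → ∑ (xs ++ ys) f ≡ ∑ xs f + ∑ ys f
  ∑-++ xs {ys} f = trans (cong sum (map-++ f xs ys)) (sum-++ (map f xs) (map f ys))

  ∑-mono : ∀ xs {f g : A → ℕ} → (∀ {x} → x ∈ₗ xs → f x ≤ g x) → ∑ xs f ≤ ∑ xs g
  ∑-mono []       f≤g = z≤n
  ∑-mono (x ∷ xs) f≤g = +-mono-≤ (f≤g (here refl)) (∑-mono xs (f≤g ∘ there))

  ∑-const : ∀ (xs : List A) c → ∑ xs (λ _ → c) ≡ length xs * c
  ∑-const []       c = refl
  ∑-const (x ∷ xs) c = cong (c +_) (∑-const xs c)

  ∑-*ʳ : ∀ xs (f : A → ℕ) c → ∑ xs (λ x → f x * c) ≡ ∑ xs f * c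
  ∑-*ʳ []       f c = refl
  ∑-*ʳ (x ∷ xs) f c = trans (cong (f x * c +_) (∑-*ʳ xs f c)) (sym (*-distribʳ-+ c (f x) (∑ xs f)))

  -- Over the integers each strict inequality gains one. The gains are kept as `length xs`, so that
  -- strictness survives the later division by `t` in `∑ω<n!`.
  length+∑≤ : ∀ (xs : List A) f {c} → (∀ x → f x < c) → length xs + ∑ xs f ≤ length xs * c
  length+∑≤ []       f     f<c = z≤n
  length+∑≤ (x ∷ xs) f {c} f<c = begin
    suc (length xs + (f x + ∑ xs f))   ≡⟨ cong suc (x∙yz≈y∙xz (length xs) (f x) (∑ xs f)) ⟩
    suc (f x) + (length xs + ∑ xs f)   ≤⟨ +-mono-≤ (f<c x) (length+∑≤ xs f f<c) ⟩
    c + length xs * c                  ∎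
    where open ≤-Reasoning

  ∑-map : {B : Set} (g : A → B) (f : B → ℕ) → ∀ xs → ∑ (map g xs) f ≡ ∑ xs (f ∘ g)
  ∑-map g f []       = refl
  ∑-map g f (x ∷ xs) = cong (f (g x) +_) (∑-map g f xs)

  ∑-concatMap : {B : Set} (g : B → List A) (f : A → ℕ) → ∀ xs → ∑ (concatMap g xs) f ≡ ∑ xs (λ x → ∑ (g x) f)
  ∑-concatMap g f []       = refl
  ∑-concatMap g f (x ∷ xs) = trans (∑-++ (g x) f) (cong (∑ (g x) f +_) (∑-concatMap g f xs))

  ∑-drop-mid : ∀ xs {y ys} (f : A → ℕ) → ∑ (xs ++ y ∷ ys) f ≡ f y + ∑ (xs ++ ys) f
  ∑-drop-mid []       f = refl
  ∑-drop-mid (x ∷ xs) {y} {ys} f = begin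
    f x + ∑ (xs ++ y ∷ ys) f       ≡⟨ cong (f x +_) (∑-drop-mid xs f) ⟩
    f x + (f y + ∑ (xs ++ ys) f)   ≡⟨ x∙yz≈y∙xz (f x) (f y) (∑ (xs ++ ys) f) ⟩
    f y + (f x + ∑ (xs ++ ys) f)   ∎
    where open ≡-Reasoning

  ∈-drop-mid : ∀ xs {y ys} {x : A} → x ∈ₗ xs ++ y ∷ ys → x ≢ y → x ∈ₗ xs ++ ys
  ∈-drop-mid xs x∈ x≢y with ∈-++⁻ xs x∈
  ... | inj₁ x∈xs         = ∈-++⁺ˡ x∈xs
  ... | inj₂ (here x≡y)   = contradiction x≡y x≢y
  ... | inj₂ (there x∈ys) = ∈-++⁺ʳ xs x∈ys

  -- Each entry of `xs` is cancelled against one occurrence in `ys`; uniqueness of `xs` keeps its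
  -- later entries in what remains. The double counting of flags rests on this.
  ∑-unique-⊆ : ∀ {xs ys} (f : A → ℕ) → Unique xs → (∀ {x} → x ∈ₗ xs → x ∈ₗ ys) → ∑ xs f ≤ ∑ ys f
  ∑-unique-⊆ {[]}     f _  xs⊆ys = z≤n
  ∑-unique-⊆ {x ∷ xs} f (x≢ ∷ u) xs⊆ys with as , bs , refl ← ∈-∃++ (xs⊆ys (here refl)) = begin
    f x + ∑ xs f           ≤⟨ +-monoʳ-≤ (f x) (∑-unique-⊆ f u (λ y∈ → ∈-drop-mid as (xs⊆ys (there y∈)) (All.lookup x≢ y∈ ∘ sym))) ⟩
    f x + ∑ (as ++ bs) f   ≡⟨ ∑-drop-mid as f ⟨
    ∑ (as ++ x ∷ bs) f     ∎
    where open ≤-Reasoning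

  length-∑ : ∀ (xs : List A) → length xs ≡ ∑ xs (λ _ → 1)
  length-∑ xs = sym (trans (∑-const xs 1) (*-identityʳ (length xs)))

  length-unique-⊆ : ∀ {xs ys : List A} → Unique xs → (∀ {x} → x ∈ₗ xs → x ∈ₗ ys) → length xs ≤ length ys
  length-unique-⊆ {xs} {ys} u xs⊆ys rewrite length-∑ xs | length-∑ ys = ∑-unique-⊆ (λ _ → 1) u xs⊆ys

  length-concatMap-≤ : {B : Set} (g : B → List A) → ∀ xs {m} → (∀ {x} → x ∈ₗ xs → length (g x) ≤ m) →
                       length (concatMap g xs) ≤ length xs * m
  length-concatMap-≤ g []       g≤ = z≤n
  length-concatMap-≤ g (x ∷ xs) g≤ rewrite length-++ (g x) {concatMap g xs} =
    +-mono-≤ (g≤ (here refl)) (length-concatMap-≤ g xs (g≤ ∘ there))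

  -- A Markov inequality without division: an entry that fails `P` pays `c` out of its own weight,
  -- and every other entry is counted by the filter.
  length≤filter+∑ : {P : A → Set} (P? : Decidable P) (w : A → ℕ) {c : ℕ} → (∀ x → ¬ P x → c ≤ w x) → ∀ xs →
                    length xs * c ≤ length (filter P? xs) * c + ∑ xs w
  length≤filter+∑ P? w {c} c≤w []       = z≤n
  length≤filter+∑ P? w {c} c≤w (x ∷ xs) with ih ← length≤filter+∑ P? w c≤w xs | P? x
  ... | yes _  = begin
    c + length xs * c                                       ≤⟨ +-monoʳ-≤ c ih ⟩
    c + (length (filter P? xs) * c + ∑ xs w)                ≡⟨ +-assoc c _ _ ⟨
    c + length (filter P? xs) * c + ∑ xs w                  ≤⟨ +-monoʳ-≤ (c + length (filter P? xs) * c) (m≤n+m _ (w x)) ⟩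
    c + length (filter P? xs) * c + (w x + ∑ xs w)          ∎
    where open ≤-Reasoning
  ... | no ¬px = begin
    c + length xs * c                                       ≤⟨ +-mono-≤ (c≤w x ¬px) ih ⟩
    w x + (length (filter P? xs) * c + ∑ xs w)              ≡⟨ x∙yz≈y∙xz (w x) (length (filter P? xs) * c) (∑ xs w) ⟩
    length (filter P? xs) * c + (w x + ∑ xs w)              ∎
    where open ≤-Reasoning

-- Subsets of Fin n

elems : ∀ {n} → Subset n → List (Fin n)
elems []            = []
elems (inside  ∷ p) = zero ∷ map suc (elems p)
elems (outside ∷ p) = map suc (elems p)

∈-elems⁺ : ∀ {n} {x : Fin n} {p : Subset n} → x ∈ p → x ∈ₗ elems p
∈-elems⁺ {p = inside  ∷ p} here        = here refl
∈-elems⁺ {p = inside  ∷ p} (there x∈p) = there (∈-map⁺ suc (∈-elems⁺ x∈p))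
∈-elems⁺ {p = outside ∷ p} (there x∈p) = ∈-map⁺ suc (∈-elems⁺ x∈p)

∈-elems⁻ : ∀ {n} {x : Fin n} (p : Subset n) → x ∈ₗ elems p → x ∈ p
∈-elems⁻ (inside  ∷ p) (here refl) = here
∈-elems⁻ (inside  ∷ p) (there x∈) with _ , y∈ , refl ← ∈-map⁻ suc x∈ = there (∈-elems⁻ p y∈)
∈-elems⁻ (outside ∷ p) x∈         with _ , y∈ , refl ← ∈-map⁻ suc x∈ = there (∈-elems⁻ p y∈)

elems-unique : ∀ {n} (p : Subset n) → Unique (elems p)
elems-unique []            = []
elems-unique (inside  ∷ p) = All-map⁺ (All.universal (λ _ ()) (elems p)) ∷ Unique-map⁺ Fin.suc-injective (elems-unique p)
elems-unique (outside ∷ p) = Unique-map⁺ Fin.suc-injective (elems-unique p)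

length-elems : ∀ {n} (p : Subset n) → length (elems p) ≡ ∣ p ∣
length-elems []            = refl
length-elems (inside  ∷ p) = cong suc (trans (length-map suc (elems p)) (length-elems p))
length-elems (outside ∷ p) = trans (length-map suc (elems p)) (length-elems p)

x∈p-y⇒x∈p : ∀ {n} {p : Subset n} {x y} → x ∈ p - y → x ∈ p
x∈p-y⇒x∈p {p = p} {y = y} = p─q⊆p p ⁅ y ⁆

x∉p-x : ∀ {n} (p : Subset n) (x : Fin n) → x ∉ p - x
x∉p-x (_ ∷ p) zero    ()
x∉p-x (_ ∷ p) (suc x) (there x∈) = x∉p-x p x x∈

x∈p-y⇒x≢y : ∀ {n} (p : Subset n) {x y : Fin n} → x ∈ p - y → x ≢ y
x∈p-y⇒x≢y p x∈ refl = x∉p-x p _ x∈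

∣p-x∣ : ∀ {n} {p : Subset n} {x : Fin n} → x ∈ p → suc ∣ p - x ∣ ≡ ∣ p ∣
∣p-x∣ {p = inside  ∷ p} {zero}  here       = cong (suc ∘ ∣_∣) (p─⊥≡p p)
∣p-x∣ {p = inside  ∷ p} {suc x} (there x∈) = cong suc (∣p-x∣ x∈)
∣p-x∣ {p = outside ∷ p} {suc x} (there x∈) = ∣p-x∣ x∈

p-x∪x : ∀ {n} {p : Subset n} {x : Fin n} → x ∈ p → (p - x) ∪ ⁅ x ⁆ ≡ p
p-x∪x {n} {p} {x} x∈p = ⊆-antisym ⊆₁ ⊆₂
  where
  ⊆₁ : ∀ {y} → y ∈ (p - x) ∪ ⁅ x ⁆ → y ∈ p
  ⊆₁ y∈ with x∈p∪q⁻ (p - x) ⁅ x ⁆ y∈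
  ... | inj₁ y∈p-x = x∈p-y⇒x∈p {p = p} y∈p-x
  ... | inj₂ y∈x   = subst (_∈ p) (sym (x∈⁅y⁆⇒x≡y x y∈x)) x∈p
  ⊆₂ : ∀ {y} → y ∈ p → y ∈ (p - x) ∪ ⁅ x ⁆
  ⊆₂ {y} y∈ with y Fin.≟ x
  ... | yes refl = x∈p∪q⁺ (inj₂ (x∈⁅x⁆ x))
  ... | no  y≢x  = x∈p∪q⁺ (inj₁ (x∈p∧x≢y⇒x∈p-y y∈ y≢x))

subsetsOfSize : ∀ n → ℕ → List (Subset n)
subsetsOfSize zero    zero    = [] ∷ []
subsetsOfSize zero    (suc k) = []
subsetsOfSize (suc n) zero    = map (outside ∷_) (subsetsOfSize n zero)
subsetsOfSize (suc n) (suc k) = map (inside ∷_) (subsetsOfSize n k) ++ map (outside ∷_) (subsetsOfSize n (suc k))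

nC0≡1 : ∀ n → n C 0 ≡ 1
nC0≡1 n = trans (nCk≡nC[n∸k] {0} {n} z≤n) (nCn≡1 n)

length-subsetsOfSize : ∀ n k → length (subsetsOfSize n k) ≡ n C k
length-subsetsOfSize zero    zero    = refl
length-subsetsOfSize zero    (suc k) = refl
length-subsetsOfSize (suc n) zero    = begin
  length (map (outside ∷_) (subsetsOfSize n 0))   ≡⟨ length-map _ (subsetsOfSize n 0) ⟩
  length (subsetsOfSize n 0)                      ≡⟨ length-subsetsOfSize n 0 ⟩
  n C 0                                           ≡⟨ trans (nC0≡1 n) (sym (nC0≡1 (suc n))) ⟩
  suc n C 0                                       ∎
  where open ≡-Reasoning
length-subsetsOfSize (suc n) (suc k) = begin
  length (map (inside ∷_) (subsetsOfSize n k) ++ map (outside ∷_) (subsetsOfSize n (suc k)))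
    ≡⟨ length-++ (map (inside ∷_) (subsetsOfSize n k)) ⟩
  length (map (inside ∷_) (subsetsOfSize n k)) + length (map (outside ∷_) (subsetsOfSize n (suc k)))
    ≡⟨ cong₂ _+_ (trans (length-map _ (subsetsOfSize n k)) (length-subsetsOfSize n k))
                 (trans (length-map _ (subsetsOfSize n (suc k))) (length-subsetsOfSize n (suc k))) ⟩
  n C k + n C suc k
    ≡⟨ nCk+nC[k+1]≡[n+1]C[k+1] n k ⟩
  suc n C suc k ∎
  where open ≡-Reasoning

∈-subsetsOfSize : ∀ {n} (p : Subset n) {k} → ∣ p ∣ ≡ k → p ∈ₗ subsetsOfSize n k
∈-subsetsOfSize []            refl = here refl
∈-subsetsOfSize (inside  ∷ p) refl = ∈-++⁺ˡ (∈-map⁺ (inside ∷_) (∈-subsetsOfSize p refl))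
∈-subsetsOfSize (outside ∷ p) {zero}  eq = ∈-map⁺ (outside ∷_) (∈-subsetsOfSize p eq)
∈-subsetsOfSize (outside ∷ p) {suc k} eq =
  ∈-++⁺ʳ (map (inside ∷_) (subsetsOfSize _ k)) (∈-map⁺ (outside ∷_) (∈-subsetsOfSize p eq))

size-subsetsOfSize : ∀ n k → All (λ p → ∣ p ∣ ≡ k) (subsetsOfSize n k)
size-subsetsOfSize zero    zero    = refl ∷ []
size-subsetsOfSize zero    (suc k) = []
size-subsetsOfSize (suc n) zero    = All-map⁺ (size-subsetsOfSize n zero)
size-subsetsOfSize (suc n) (suc k) =
  All-++⁺ (All-map⁺ (All.map (cong suc) (size-subsetsOfSize n k))) (All-map⁺ (size-subsetsOfSize n (suc k)))

subsetsOfSize-unique : ∀ n k → Unique (subsetsOfSize n k)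
subsetsOfSize-unique zero    zero    = [] ∷ []
subsetsOfSize-unique zero    (suc k) = []
subsetsOfSize-unique (suc n) zero    = Unique-map⁺ ∷-injectiveʳ (subsetsOfSize-unique n zero)
subsetsOfSize-unique (suc n) (suc k) =
  Unique-++⁺ (Unique-map⁺ ∷-injectiveʳ (subsetsOfSize-unique n k))
             (Unique-map⁺ ∷-injectiveʳ (subsetsOfSize-unique n (suc k)))
             disjoint
  where
  disjoint : ∀ {p} → ¬ (p ∈ₗ map (inside ∷_) (subsetsOfSize n k) × p ∈ₗ map (outside ∷_) (subsetsOfSize n (suc k)))
  disjoint (p∈ , p∈′) with ∈-map⁻ (inside ∷_) p∈ | ∈-map⁻ (outside ∷_) p∈′
  ... | _ , _ , refl | _ , _ , ()

fresh : {V : Set} → DecidableEquality V → {xs : List V} (us : List V) → Unique xs → length us < length xs →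
        ∃[ x ] (x ∈ₗ xs × x ∉ₗ us)
fresh _≟_ {xs} us u us<xs with any? (λ x → ¬? (DecMembership._∈?_ _≟_ x us)) xs
... | yes p  = find p
... | no ¬p = contradiction us<xs (≤⇒≯ (length-unique-⊆ u xs⊆us))
  where
  xs⊆us : ∀ {x} → x ∈ₗ xs → x ∈ₗ us
  xs⊆us {x} x∈ with DecMembership._∈?_ _≟_ x us
  ... | yes x∈us = x∈us
  ... | no  x∉us = contradiction (lose x∈ x∉us) ¬p

-- Distinct representatives

module SDR {A V : Set} (_≟A_ : DecidableEquality A) (_≟V_ : DecidableEquality V) (v₀ : V)
           (opt : A → List V) (opt-unique : ∀ a → Unique (opt a)) (ω : A → ℕ) (P m : ℕ) where

  -- With `P` as the unit, `ω a` plays the reciprocal of a codegree exceeding the number of options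
  -- by at most one: the vertex removed to form a facet extends it but is no admissible pendant. The
  -- first alternative serves option lists cut off at `m` entries.
  Enough : A → Set
  Enough a = m ≤ length (opt a) ⊎ P ≤ ω a * suc (length (opt a))

  -- Otherwise every weight is at least P / length as, and the weights sum to at least P.
  rich-task : ∀ a as → let l = length (a ∷ as) in l ≤ m → (∀ {b} → b ∈ₗ a ∷ as → Enough b) →
              ∑ (a ∷ as) ω < P → ∃[ b ] (b ∈ₗ a ∷ as × l ≤ length (opt b))
  rich-task a as l≤m enough ∑<P with any? (λ b → length (a ∷ as) ≤? length (opt b)) (a ∷ as)
  ... | yes p = find p
  ... | no ¬p = contradiction ∑<P (≤⇒≯ (*-cancelʳ-≤ P (∑ (a ∷ as) ω) l P*l≤))
    where
    l = length (a ∷ as)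
    P≤ : ∀ {b} → b ∈ₗ a ∷ as → P ≤ ω b * l
    P≤ {b} b∈ with ≰⇒> (λ l≤ → ¬p (lose b∈ l≤)) | enough b∈
    ... | opt<l | inj₁ m≤  = contradiction (≤-trans l≤m m≤) (<⇒≱ opt<l)
    ... | opt<l | inj₂ P≤′ = ≤-trans P≤′ (*-monoʳ-≤ (ω b) opt<l)
    P*l≤ : P * l ≤ ∑ (a ∷ as) ω * l
    P*l≤ = begin
      P * l                         ≡⟨ *-comm P l ⟩
      l * P                         ≡⟨ ∑-const (a ∷ as) P ⟨
      ∑ (a ∷ as) (λ _ → P)          ≤⟨ ∑-mono (a ∷ as) P≤ ⟩
      ∑ (a ∷ as) (λ b → ω b * l)    ≡⟨ ∑-*ʳ (a ∷ as) ω l ⟩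
      ∑ (a ∷ as) ω * l              ∎
      where open ≤-Reasoning

  Represents : List A → (A → V) → Set
  Represents as g = (∀ {a} → a ∈ₗ as → g a ∈ₗ opt a) × (∀ {a b} → a ∈ₗ as → b ∈ₗ as → g a ≡ g b → a ≡ b)

  update : A → V → (A → V) → A → V
  update a v g b with b ≟A a
  ... | yes _ = v
  ... | no  _ = g b

  update-represents : ∀ {xs ys a v g} → v ∈ₗ opt a → v ∉ₗ map g (xs ++ ys) → Represents (xs ++ ys) g →
                      Represents (xs ++ a ∷ ys) (update a v g)
  update-represents {xs} {ys} {a} {v} {g} v∈ v∉ (g∈ , g-inj) = ∈opt , inj
    where
    ∈opt : ∀ {b} → b ∈ₗ xs ++ a ∷ ys → update a v g b ∈ₗ opt b
    ∈opt {b} b∈ with b ≟A a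
    ... | yes refl = v∈
    ... | no  b≢a  = g∈ (∈-drop-mid xs b∈ b≢a)
    inj : ∀ {b c} → b ∈ₗ xs ++ a ∷ ys → c ∈ₗ xs ++ a ∷ ys → update a v g b ≡ update a v g c → b ≡ c
    inj {b} {c} b∈ c∈ eq with b ≟A a | c ≟A a
    ... | yes refl | yes refl = refl
    ... | yes refl | no  c≢a  = contradiction (subst (_∈ₗ _) (sym eq) (∈-map⁺ g (∈-drop-mid xs c∈ c≢a))) v∉
    ... | no  b≢a  | yes refl = contradiction (subst (_∈ₗ _) eq (∈-map⁺ g (∈-drop-mid xs b∈ b≢a))) v∉
    ... | no  b≢a  | no  c≢a  = g-inj (∈-drop-mid xs b∈ b≢a) (∈-drop-mid xs c∈ c≢a) eq

  -- Greedy choice in reverse: a task with at least `l` options is set aside, the other `l - 1`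
  -- tasks are represented first, and they block at most `l - 1` of its options. Passing to fewer
  -- tasks only lowers the sum of weights, so the hypotheses persist.
  sdr : ∀ l as → length as ≡ l → l ≤ m → (∀ {a} → a ∈ₗ as → Enough a) → ∑ as ω < P → ∃[ g ] Represents as g
  -- Outside the tasks the representative is the arbitrary value `v₀`.
  sdr zero    []        _    _   _      _   = (λ _ → v₀) , (λ ()) , λ ()
  sdr (suc l) (a₀ ∷ as₀) len₀ l≤m enough ∑<P with rich-task a₀ as₀ (≤-trans (≤-reflexive len₀) l≤m) enough ∑<P
  ... | a , a∈ , l≤opt with ∈-∃++ a∈
  ... | xs , ys , eq = update a v g , subst (λ zs → Represents zs (update a v g)) (sym eq) (update-represents v∈ v∉ (proj₂ rest))
    where
    len : suc (length (xs ++ ys)) ≡ suc l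
    len = trans (sym (length-++-sucʳ xs a ys)) (trans (cong length (sym eq)) len₀)
    keep : ∀ {b} → b ∈ₗ xs ++ ys → b ∈ₗ a₀ ∷ as₀
    keep b∈ = subst (_ ∈ₗ_) (sym eq) ([ ∈-++⁺ˡ , ∈-++⁺ʳ xs ∘ there ]′ (∈-++⁻ xs b∈))
    ∑rest≤ : ∑ (xs ++ ys) ω ≤ ∑ (a₀ ∷ as₀) ω
    ∑rest≤ = begin
      ∑ (xs ++ ys) ω         ≤⟨ m≤n+m _ (ω a) ⟩
      ω a + ∑ (xs ++ ys) ω   ≡⟨ ∑-drop-mid xs ω ⟨
      ∑ (xs ++ a ∷ ys) ω     ≡⟨ cong (λ zs → ∑ zs ω) eq ⟨
      ∑ (a₀ ∷ as₀) ω         ∎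
      where open ≤-Reasoning
    rest : ∃[ g ] Represents (xs ++ ys) g
    rest = sdr l (xs ++ ys) (suc-injective len) (≤-trans (n≤1+n l) l≤m) (enough ∘ keep) (≤-<-trans ∑rest≤ ∑<P)
    g = proj₁ rest
    new : ∃[ v ] (v ∈ₗ opt a × v ∉ₗ map g (xs ++ ys))
    new = fresh _≟V_ (map g (xs ++ ys)) (opt-unique a)
            (≤-trans (≤-reflexive (trans (cong suc (length-map g (xs ++ ys))) (trans len (sym len₀)))) l≤opt)
    v = proj₁ new
    v∈ = proj₁ (proj₂ new)
    v∉ = proj₂ (proj₂ new)

-- Sets closed under a map of bounded out-degree

-- Ordered lists with repetitions overcount the sets, but only within the order `n ^ m`; `toSubset`
-- later forgets order and repetition.
tuples : ∀ n → ℕ → List (List (Fin n))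
tuples n zero    = [] ∷ []
tuples n (suc m) = concatMap (λ S → map (_∷ S) (allFin n)) (tuples n m)

length-tuples : ∀ n m → length (tuples n m) ≤ n ^ m
length-tuples n zero    = ≤-refl
length-tuples n (suc m) = begin
  length (tuples n (suc m))   ≤⟨ length-concatMap-≤ (λ S → map (_∷ S) (allFin n)) (tuples n m)
                                   (λ {S} _ → ≤-reflexive (trans (length-map (_∷ S) (allFin n)) (length-tabulate {n = n} (λ i → i)))) ⟩
  length (tuples n m) * n     ≤⟨ *-monoˡ-≤ n (length-tuples n m) ⟩
  n ^ m * n                   ≡⟨ *-comm (n ^ m) n ⟩
  n * n ^ m                   ∎
  where open ≤-Reasoning

∈-tuples : ∀ {n} (S : List (Fin n)) → S ∈ₗ tuples n (length S)
∈-tuples []      = here refl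
∈-tuples (x ∷ S) = ∈-concatMap⁺ (λ S′ → map (_∷ S′) (allFin _)) (lose (∈-tuples S) (∈-map⁺ (_∷ S) (∈-allFin x)))

length-∈-tuples : ∀ n m {S} → S ∈ₗ tuples n m → length S ≡ m
length-∈-tuples n zero    (here refl) = refl
length-∈-tuples n (suc m) S∈ with find (∈-concatMap⁻ (λ S′ → map (_∷ S′) (allFin n)) {xs = tuples n m} S∈)
... | S′ , S′∈ , S∈map with _ , _ , refl ← ∈-map⁻ (_∷ S′) S∈map = cong suc (length-∈-tuples n m S′∈)

toSubset : ∀ {n} → List (Fin n) → Subset n
toSubset S = ⋃ (map ⁅_⁆ S)

∈-toSubset⁺ : ∀ {n} {x : Fin n} {S} → x ∈ₗ S → x ∈ toSubset S
∈-toSubset⁺ {x = x} (here refl) = x∈p∪q⁺ (inj₁ (x∈⁅x⁆ x))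
∈-toSubset⁺         (there x∈)  = x∈p∪q⁺ (inj₂ (∈-toSubset⁺ x∈))

∈-toSubset⁻ : ∀ {n} {x : Fin n} S → x ∈ toSubset S → x ∈ₗ S
∈-toSubset⁻ []      x∈ = contradiction x∈ ∉⊥
∈-toSubset⁻ (y ∷ S) x∈ with x∈p∪q⁻ ⁅ y ⁆ (toSubset S) x∈
... | inj₁ x∈y = here (x∈⁅y⁆⇒x≡y y x∈y)
... | inj₂ x∈S = there (∈-toSubset⁻ S x∈S)

module Closed {n : ℕ} (X : Fin n → List (Fin n)) (irrefl : ∀ v → v ∉ₗ X v)
              (M : ℕ) (X≤M : ∀ v → length (X v) ≤ M) where

  Closed : Subset n → Set
  Closed e = ∀ {v} → v ∈ e → ∃[ w ] (w ∈ₗ X v × w ∈ e)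

  -- A certificate that `e` can be rebuilt from `e - a - b`: first `a` is found in `X u` with `u`
  -- among the remaining vertices, then `b` in `X u′`, where `u′` may be `a` itself.
  Generated : Subset n → Set
  Generated e = ∃[ a ] ∃[ b ] ∃[ u ] ∃[ u′ ] (a ∈ e × b ∈ e × a ≢ b × u ∈ e × u ≢ a × u ≢ b × a ∈ₗ X u
                                           × u′ ∈ e × u′ ≢ b × b ∈ₗ X u′)

  -- Follow x → y → z inside `e`. If z differs from x, then y and z are recovered in this order,
  -- starting from x. Otherwise x and y point to each other, and a third vertex w, present because
  -- `e` has at least three, points to some w′. If w′ is x or y, it is recovered from w and the
  -- other of the two from it; if not, w′ is recovered from w and y from x.
  closed⇒generated : ∀ e {m} → ∣ e ∣ ≡ 3 + m → Closed e → Generated e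
  closed⇒generated e {m} ∣e∣ cl with elems e in eq
  ... | [] = contradiction (trans (sym (cong length eq)) (trans (length-elems e) ∣e∣)) λ ()
  ... | x ∷ _ with x∈ ← ∈-elems⁻ e (subst (x ∈ₗ_) (sym eq) (here refl))
              with y , y∈X , y∈ ← cl x∈
              with z , z∈X , z∈ ← cl y∈
              with z Fin.≟ x
  ... | no z≢x = y , z , x , y , y∈ , z∈ , irr z∈X , x∈ , irr y∈X , (z≢x ∘ sym) , y∈X , y∈ , irr z∈X , z∈X
    where
    irr : ∀ {a b} → b ∈ₗ X a → a ≢ b
    irr b∈ refl = irrefl _ b∈
  ... | yes refl = third (elems (e - x - y)) refl
    where
    irr : ∀ {a b} → b ∈ₗ X a → a ≢ b
    irr b∈ refl = irrefl _ b∈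
    y∈′ : y ∈ e - x
    y∈′ = x∈p∧x≢y⇒x∈p-y y∈ (irr z∈X)
    size : suc (suc ∣ e - x - y ∣) ≡ 3 + m
    size = trans (cong suc (∣p-x∣ y∈′)) (trans (∣p-x∣ x∈) ∣e∣)
    third : ∀ ws → elems (e - x - y) ≡ ws → Generated e
    third [] eq = contradiction (trans (sym size) (cong (λ l → suc (suc l)) (trans (sym (length-elems (e - x - y))) (cong length eq)))) λ ()
    third (w ∷ _) eq = cases
      where
      w∈″ : w ∈ e - x - y
      w∈″ = ∈-elems⁻ (e - x - y) (subst (w ∈ₗ_) (sym eq) (here refl))
      w∈′ : w ∈ e - x
      w∈′ = x∈p-y⇒x∈p {p = e - x} w∈″
      w∈ : w ∈ e
      w∈ = x∈p-y⇒x∈p {p = e} w∈′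
      w≢y : w ≢ y
      w≢y = x∈p-y⇒x≢y (e - x) w∈″
      w≢x : w ≢ x
      w≢x = x∈p-y⇒x≢y e w∈′
      cases : Generated e
      cases with w′ , w′∈X , w′∈ ← cl w∈ with w′ Fin.≟ x | w′ Fin.≟ y
      ... | yes refl | _        = x , y , w , x , x∈ , y∈ , irr y∈X , w∈ , w≢x , w≢y , w′∈X , x∈ , irr y∈X , y∈X
      ... | no _     | yes refl = y , x , w , y , y∈ , x∈ , irr z∈X , w∈ , w≢y , w≢x , w′∈X , y∈ , irr z∈X , z∈X
      ... | no w′≢x  | no w′≢y  = w′ , y , w , x , w′∈ , y∈ , w′≢y , w∈ , irr w′∈X , w≢y , w′∈X , x∈ , irr y∈X , y∈X

  extend : List (Fin n) → List (List (Fin n))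
  extend S = map (_∷ S) (concatMap X S)

  length-extend : ∀ S {l} → length S ≡ l → length (extend S) ≤ l * M
  length-extend S refl = ≤-trans (≤-reflexive (length-map (_∷ S) (concatMap X S))) (length-concatMap-≤ X S (λ {v} _ → X≤M v))

  ∈-extend : ∀ {S u a} → u ∈ₗ S → a ∈ₗ X u → (a ∷ S) ∈ₗ extend S
  ∈-extend {S} u∈ a∈ = ∈-map⁺ (_∷ S) (∈-concatMap⁺ X (lose u∈ a∈))

  -- Two extensions of `m`-tuples, one for each vertex to be recovered. The second starts from lists
  -- of length `suc m`, whence the two different factors in the count.
  candidates : ℕ → List (List (Fin n))
  candidates m = concatMap extend (concatMap extend (tuples n m))

  length-candidates : ∀ m → length (candidates m) ≤ (m * M * (suc m * M)) * n ^ m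
  length-candidates m = begin
    length (candidates m)                                          ≤⟨ length-concatMap-≤ extend (concatMap extend (tuples n m)) (λ {S} S∈ → length-extend S (len S∈)) ⟩
    length (concatMap extend (tuples n m)) * (suc m * M)           ≤⟨ *-monoˡ-≤ (suc m * M) (length-concatMap-≤ extend (tuples n m) (λ {S} S∈ → length-extend S (length-∈-tuples n m S∈))) ⟩
    length (tuples n m) * (m * M) * (suc m * M)                    ≤⟨ *-monoˡ-≤ (suc m * M) (*-monoˡ-≤ (m * M) (length-tuples n m)) ⟩
    n ^ m * (m * M) * (suc m * M)                                  ≡⟨ trans (*-assoc (n ^ m) (m * M) (suc m * M)) (*-comm (n ^ m) _) ⟩
    (m * M * (suc m * M)) * n ^ m                                  ∎
    where
    open ≤-Reasoning
    len : ∀ {S} → S ∈ₗ concatMap extend (tuples n m) → length S ≡ suc m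
    len S∈ with find (∈-concatMap⁻ extend {xs = tuples n m} S∈)
    ... | S′ , S′∈ , S∈ext with _ , _ , refl ← ∈-map⁻ (_∷ S′) S∈ext = cong suc (length-∈-tuples n m S′∈)

  ∈-candidates : ∀ e {m} → ∣ e ∣ ≡ 3 + m → Closed e → e ∈ₗ map toSubset (candidates (suc m))
  ∈-candidates e {m} ∣e∣ cl
    with a , b , u , u′ , a∈ , b∈ , a≢b , u∈ , u≢a , u≢b , a∈X , u′∈ , u′≢b , b∈X ← closed⇒generated e ∣e∣ cl
    = subst (_∈ₗ map toSubset (candidates (suc m))) same (∈-map⁺ toSubset bas∈)
    where
    S = elems (e - a - b)
    b∈′ : b ∈ e - a
    b∈′ = x∈p∧x≢y⇒x∈p-y b∈ (a≢b ∘ sym)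
    lenS : length S ≡ suc m
    lenS = trans (length-elems (e - a - b)) (suc-injective (suc-injective (trans (cong suc (∣p-x∣ b∈′)) (trans (∣p-x∣ a∈) ∣e∣))))
    in-S : ∀ {x} → x ∈ e → x ≢ a → x ≢ b → x ∈ₗ S
    in-S x∈ x≢a x≢b = ∈-elems⁺ (x∈p∧x≢y⇒x∈p-y (x∈p∧x≢y⇒x∈p-y x∈ x≢a) x≢b)
    in-aS : ∀ {x} → x ∈ e → x ≢ b → x ∈ₗ a ∷ S
    in-aS {x} x∈ x≢b with x Fin.≟ a
    ... | yes refl = here refl
    ... | no  x≢a  = there (in-S x∈ x≢a x≢b)
    in-baS : ∀ {x} → x ∈ e → x ∈ₗ b ∷ a ∷ S
    in-baS {x} x∈ with x Fin.≟ b
    ... | yes refl = here refl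
    ... | no  x≢b  = there (in-aS x∈ x≢b)
    bas∈ : (b ∷ a ∷ S) ∈ₗ candidates (suc m)
    bas∈ = ∈-concatMap⁺ extend (lose
             (∈-concatMap⁺ extend (lose (subst (λ l → S ∈ₗ tuples n l) lenS (∈-tuples S)) (∈-extend (in-S u∈ u≢a u≢b) a∈X)))
             (∈-extend (in-aS u′∈ u′≢b) b∈X))
    from-baS : ∀ {x} → x ∈ₗ b ∷ a ∷ S → x ∈ e
    from-baS (here refl)         = b∈
    from-baS (there (here refl)) = a∈
    from-baS (there (there x∈))  = x∈p-y⇒x∈p {p = e} (x∈p-y⇒x∈p {p = e - a} (∈-elems⁻ (e - a - b) x∈))
    same : toSubset (b ∷ a ∷ S) ≡ e
    same = ⊆-antisym (from-baS ∘ ∈-toSubset⁻ (b ∷ a ∷ S)) (∈-toSubset⁺ ∘ in-baS)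

  -- Here r is `3 + m`. Each closed set comes from a candidate over an (r-2)-tuple, and the two
  -- recovered vertices cost only factors that do not depend on `n`.
  closed-count : ∀ {G m} → Unique G → (∀ {e} → e ∈ₗ G → ∣ e ∣ ≡ 3 + m × Closed e) →
                 length G ≤ (suc m * M * (suc (suc m) * M)) * n ^ suc m
  closed-count {G} {m} u G-closed = begin
    length G                                   ≤⟨ length-unique-⊆ u (λ {e} e∈ → ∈-candidates e (proj₁ (G-closed e∈)) (proj₂ (G-closed e∈))) ⟩
    length (map toSubset (candidates (suc m))) ≡⟨ length-map toSubset (candidates (suc m)) ⟩
    length (candidates (suc m))                ≤⟨ length-candidates (suc m) ⟩
    (suc m * M * (suc (suc m) * M)) * n ^ suc m  ∎
    where open ≤-Reasoning

-- Stars of edges meeting in a single vertex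

AllPairs-lookup : {A : Set} {R : A → A → Set} → Symmetric R → ∀ {xs} → AllPairs R xs →
                  ∀ i j → i ≢ j → R (lookup xs i) (lookup xs j)
AllPairs-lookup R-sym (rs ∷ ap) zero    zero    i≢j = contradiction refl i≢j
AllPairs-lookup R-sym (rs ∷ ap) zero    (suc j) i≢j = All.lookup rs (∈-lookup j)
AllPairs-lookup R-sym (rs ∷ ap) (suc i) zero    i≢j = R-sym (All.lookup rs (∈-lookup i))
AllPairs-lookup R-sym (rs ∷ ap) (suc i) (suc j) i≢j = AllPairs-lookup R-sym ap i j (i≢j ∘ cong suc)

module Star {n : ℕ} (E : Subset n → List (Fin n)) (E-disjoint : ∀ e → All (_∉ e) (E e))
            (G : List (Subset n)) {r : ℕ} (size : ∀ {e} → e ∈ₗ G → ∣ e ∣ ≡ suc r)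
            (M : ℕ) (E≤M : ∀ {e} → e ∈ₗ G → length (E e) ≤ M) (v : Fin n) where

  -- What later edges of the star have to avoid: the rest of `e` together with all its candidate
  -- pendants `E e`.
  petal : Subset n → List (Fin n)
  petal e = elems (e - v) ++ E e

  v∉petal : ∀ {e} → v ∈ e → v ∉ₗ petal e
  v∉petal {e} v∈e v∈ with ∈-++⁻ (elems (e - v)) v∈
  ... | inj₁ v∈e-v = x∉p-x e v (∈-elems⁻ (e - v) v∈e-v)
  ... | inj₂ v∈E   = All.lookup (E-disjoint e) v∈E v∈e

  -- One-sided: `e` is added after `e′` and misses the petal of `e′`, while candidates in `E e` may
  -- still lie on `e′`. The symmetric `Separated` is reached only in `separate`.
  Avoids : Subset n → Subset n → Set
  Avoids e e′ = All (_∉ e) (petal e′)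

  avoids⇒meet-in-v : ∀ {e e′} → Avoids e e′ → ∀ {x} → x ∈ e → x ∈ e′ → x ≡ v
  avoids⇒meet-in-v {e} {e′} av {x} x∈e x∈e′ with x Fin.≟ v
  ... | yes x≡v = x≡v
  ... | no  x≢v = contradiction x∈e (All.lookup av (∈-++⁺ˡ (∈-elems⁺ (x∈p∧x≢y⇒x∈p-y x∈e′ x≢v))))

  -- Greedy extension. If no edge of `G` through `v` misses all petals so far, then the union of
  -- these petals is itself a blocking set. Each petal has at most `r + M` entries and does not
  -- contain `v`.
  grow : ∀ s →
         (∃[ es ] (length es ≡ s × All (λ e → e ∈ₗ G × v ∈ e) es × AllPairs Avoids es))
         ⊎ (∃[ X ] (length X ≤ s * (r + M) × v ∉ₗ X × (∀ {e} → e ∈ₗ G → v ∈ e → ∃[ w ] (w ∈ₗ X × w ∈ e))))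
  grow zero = inj₁ ([] , refl , [] , [])
  grow (suc s) with grow s
  ... | inj₂ (X , X≤ , rest) = inj₂ (X , ≤-trans X≤ (m≤n+m _ (r + M)) , rest)
  ... | inj₁ (es , refl , es∈ , ap)
    with any? (λ e → (v ∈? e) ×-dec All.all? (λ x → ¬? (x ∈? e)) (concatMap petal es)) G
  ... | yes p with e , e∈G , v∈e , av ← find p =
    inj₁ (e ∷ es , refl , (e∈G , v∈e) ∷ es∈ , All.tabulate (λ e′∈ → All.tabulate (λ x∈ → All.lookup av (∈-concatMap⁺ petal (lose e′∈ x∈)))) ∷ ap)
  ... | no ¬p = inj₂ (concatMap petal es , ≤-trans short (m≤n+m _ (r + M)) , v∉X , hit)
    where
    short : length (concatMap petal es) ≤ length es * (r + M)
    short = length-concatMap-≤ petal es λ {e} e∈ → let (e∈G , v∈e) = All.lookup es∈ e∈ in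
      ≤-trans (≤-reflexive (length-++ (elems (e - v))))
              (+-mono-≤ (≤-reflexive (trans (length-elems (e - v)) (suc-injective (trans (∣p-x∣ v∈e) (size e∈G))))) (E≤M e∈G))
    v∉X : v ∉ₗ concatMap petal es
    v∉X v∈ with e , e∈ , v∈e ← find (∈-concatMap⁻ petal {xs = es} v∈) = v∉petal (proj₂ (All.lookup es∈ e∈)) v∈e
    hit : ∀ {e} → e ∈ₗ G → v ∈ e → ∃[ w ] (w ∈ₗ concatMap petal es × w ∈ e)
    hit {e} e∈ v∈e with any? (_∈? e) (concatMap petal es)
    ... | yes q = find q
    ... | no ¬q = contradiction (lose e∈ (v∈e , ¬Any⇒All¬ _ ¬q)) ¬p

  -- Two edges of the star share only `v`, so a vertex `y` other than `v` lies on at most one of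
  -- them.
  drop-one : ∀ y es → y ≢ v → AllPairs Avoids es → length es ≤ suc (length (filter (λ e → ¬? (y ∈? e)) es))
  drop-one y []       y≢v _ = z≤n
  drop-one y (e ∷ es) y≢v (av ∷ ap) with y ∈? e
  ... | no _ = s≤s (drop-one y es y≢v ap)
  ... | yes y∈e = s≤s (≤-reflexive (cong length (sym (filter-all (λ e′ → ¬? (y ∈? e′)) (All.map (λ av′ y∈e′ → y≢v (avoids⇒meet-in-v av′ y∈e y∈e′)) av)))))

  -- Iterates `drop-one`: freeing the star from the vertices of `Ys` costs at most one edge per
  -- vertex. The predicate `Q` is carried along so that `separate` keeps what it knows about the
  -- surviving edges.
  clear : ∀ Ys es {Q : Subset n → Set} → v ∉ₗ Ys → AllPairs Avoids es → All Q es →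
          ∃[ es′ ] (length es ≤ length Ys + length es′ × AllPairs Avoids es′ × All Q es′ × All (λ e → All (_∉ e) Ys) es′)
  clear []       es v∉ ap qs = es , ≤-refl , ap , qs , All.universal (λ _ → []) es
  clear (y ∷ Ys) es v∉ ap qs
    with es′ , len , ap′ , qs′ , cl ← clear Ys (filter (λ e → ¬? (y ∈? e)) es) (v∉ ∘ there)
                                       (AllPairs-filter⁺ (λ e → ¬? (y ∈? e)) ap)
                                       (All.zip (All-filter (λ e → ¬? (y ∈? e)) es , All-filter⁺ (λ e → ¬? (y ∈? e)) qs))
    = es′ , ≤-trans (drop-one y es (λ { refl → v∉ (here refl) }) ap) (s≤s len) , ap′ , All.map proj₂ qs′
    , All.zipWith (λ { ((y∉ , _) , ys∉) → y∉ ∷ ys∉ }) (qs′ , cl)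

  Separated : Subset n → Subset n → Set
  Separated e e′ = (∀ {x} → x ∈ e → x ∈ e′ → x ≡ v) × All (_∉ e′) (E e) × All (_∉ e) (E e′)

  separated-sym : Symmetric Separated
  separated-sym (meet , c , c′) = (λ x∈ x∈′ → meet x∈′ x∈) , c′ , c

  separated : ∀ {e e′} → Avoids e e′ → All (_∉ e′) (E e) → Separated e e′
  separated {e′ = e′} av cl =
    avoids⇒meet-in-v av , cl , All.tabulate (λ x∈ → All.lookup av (∈-++⁺ʳ (elems (e′ - v)) x∈))

  -- The petals are disjoint, so each E e meets at most M of them.
  separate : ∀ t es {Q : Subset n → Set} → (∀ {e} → Q e → e ∈ₗ G) → t * suc M ≤ length es → All (λ e → Q e × v ∈ e) es → AllPairs Avoids es →
             ∃[ es′ ] (length es′ ≡ t × All (λ e → Q e × v ∈ e) es′ × AllPairs Separated es′)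
  separate zero    es       Q⇒G len es∈ ap = [] , refl , [] , []
  separate (suc t) (e ∷ es) {Q} Q⇒G (s≤s len) ((q , v∈e) ∷ es∈) (av ∷ ap)
    with es₁ , len₁ , ap₁ , es₁∈ , clear₁ ← clear (E e) es (λ v∈E → All.lookup (E-disjoint e) v∈E v∈e) ap (All.zip (es∈ , av))
    with es₂ , len₂ , es₂∈ , sep ← separate t es₁ {λ e′ → Q e′ × Separated e e′} (Q⇒G ∘ proj₁)
           (+-cancelˡ-≤ M _ _ (≤-trans len (≤-trans len₁ (+-monoˡ-≤ _ (E≤M (Q⇒G q))))))
           (All.zipWith (λ { (((q′ , v∈) , av′) , cl) → (q′ , separated av′ cl) , v∈ }) (es₁∈ , clear₁)) ap₁
    = e ∷ es₂ , cong suc len₂ , (q , v∈e) ∷ All.map (λ ((q′ , _) , v∈) → q′ , v∈) es₂∈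
    , All.map (proj₂ ∘ proj₁) es₂∈ ∷ sep

index-pairs : {A : Set} {R : A → A → Set} {Q : A → Set} → Symmetric R → ∀ {t} xs → length xs ≡ t → All Q xs → AllPairs R xs →
              Σ (Fin t → A) λ e → (∀ i → Q (e i)) × (∀ i j → i ≢ j → R (e i) (e j))
index-pairs R-sym xs refl qs ap = lookup xs , (λ i → All.lookup qs (∈-lookup i)) , AllPairs-lookup R-sym ap

abstract
  -- Putting `v` at index zero matches `copyVert`, where index zero is the center. Omitting index j
  -- from the enumeration of a star edge then gives the facet for hyperedge j of the copy.
  enumerate : ∀ {n k} (e : Subset n) {v} → v ∈ e → ∣ e ∣ ≡ suc k →
              Σ (Fin (suc k) → Fin n) λ φ → φ zero ≡ v × Injective _≡_ _≡_ φ × (∀ j → φ j ∈ e) × (∀ {x} → x ∈ e → ∃[ j ] φ j ≡ x)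
  enumerate {n} {k} e {v} v∈e ∣e∣ = go (elems (e - v)) refl
                                    (trans (length-elems (e - v)) (suc-injective (trans (∣p-x∣ v∈e) ∣e∣)))
    where
    go : ∀ {k} xs → elems (e - v) ≡ xs → length xs ≡ k →
         Σ (Fin (suc k) → Fin n) λ φ → φ zero ≡ v × Injective _≡_ _≡_ φ × (∀ j → φ j ∈ e) × (∀ {x} → x ∈ e → ∃[ j ] φ j ≡ x)
    go xs refl refl = lookup (v ∷ xs) , refl , injective , into , onto
      where
      distinct : Unique (v ∷ xs)
      distinct = All.tabulate (λ y∈ v≡y → x∈p-y⇒x≢y e (∈-elems⁻ (e - v) y∈) (sym v≡y)) ∷ elems-unique (e - v)
      injective : Injective _≡_ _≡_ (lookup (v ∷ xs))
      injective {i} {j} eq with i Fin.≟ j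
      ... | yes i≡j = i≡j
      ... | no  i≢j = contradiction eq (AllPairs-lookup (λ x≢y → x≢y ∘ sym) distinct i j i≢j)
      into : ∀ j → lookup (v ∷ xs) j ∈ e
      into zero    = v∈e
      into (suc j) = x∈p-y⇒x∈p {p = e} (∈-elems⁻ (e - v) (∈-lookup j))
      onto : ∀ {x} → x ∈ e → ∃[ j ] lookup (v ∷ xs) j ≡ x
      onto {x} x∈ with x Fin.≟ v
      ... | yes refl = zero , refl
      ... | no  x≢v  = let x∈xs = ∈-elems⁺ (x∈p∧x≢y⇒x∈p-y x∈ x≢v) in suc (index x∈xs) , sym (lookup-index x∈xs)

-- The upper bound

module UpperBound {n k : ℕ} (t : ℕ) (0<t : 0 < t) (H : Hypergraph (suc k) n) where

  Es = edges H

  ∣Es∣ : ∀ {e} → e ∈ₗ Es → ∣ e ∣ ≡ suc k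
  ∣Es∣ = All.lookup (uniform H)

  _∈E? : ∀ e → Dec (e ∈ₗ Es)
  e ∈E? = DecMembership._∈?_ (Vec-≡-dec _≟ᵇ_) e Es

  extends? : ∀ L y → Dec (y ∉ L × (L ∪ ⁅ y ⁆) ∈ₗ Es)
  extends? L y = ¬? (y ∈? L) ×-dec ((L ∪ ⁅ y ⁆) ∈E?)

  -- Codegrees, edge weights and good edges

  ext : Subset n → List (Fin n)
  ext L = filter (extends? L) (allFin n)

  ext-unique : ∀ L → Unique (ext L)
  ext-unique L = Unique-filter⁺ (extends? L) (allFin⁺ n)

  codeg : Subset n → ℕ
  codeg L = length (ext L)

  codeg≤n : ∀ L → codeg L ≤ n
  codeg≤n L = ≤-trans (length-filter (extends? L) (allFin n)) (≤-reflexive (length-tabulate {n = n} (λ i → i)))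

  ∈-ext : ∀ {e x} → e ∈ₗ Es → x ∈ e → x ∈ₗ ext (e - x)
  ∈-ext {e} {x} e∈ x∈ = ∈-filter⁺ (extends? (e - x)) (∈-allFin x) (x∉p-x e x , subst (_∈ₗ Es) (sym (p-x∪x x∈)) e∈)

  -- Scaled by n !, which every 1 ≤ d ≤ n divides; the value at 0 is junk.
  inverse : ℕ → ℕ
  inverse zero    = 0
  inverse (suc d) = n ! / suc d

  *-inverse-≤ : ∀ d → d * inverse d ≤ n !
  *-inverse-≤ zero    = z≤n
  *-inverse-≤ (suc d) = ≤-trans (≤-reflexive (*-comm (suc d) (n ! / suc d))) (m/n*n≤m (n !) (suc d))

  inverse-* : ∀ {d} → 0 < d → d ≤ n → inverse d * d ≡ n !
  inverse-* {suc d} _ d≤n = m/n*n≡m (∣-trans (m∣m*n (d !)) (m≤n⇒m!∣n! d≤n))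

  w : Subset n → ℕ
  w L = inverse (codeg L)

  W : Subset n → ℕ
  W e = ∑ (elems e) (λ x → w (e - x))

  flags : Subset n → List (Subset n × Fin n)
  flags e = map (λ x → e - x , x) (elems e)

  -- The edge is recovered from a flag (L, x) as `L ∪ ⁅ x ⁆`, so different edges have no flag in
  -- common.
  flags-unique : Unique (concatMap flags Es)
  flags-unique = Unique-concat⁺
    (All-map⁺ (All.universal (λ e → Unique-map⁺ (cong proj₂) (elems-unique e)) Es))
    (AllPairs-map⁺ (AllPairs.map (λ {e} {e′} e≢e′ → λ { (p∈ , p∈′) → e≢e′ (same p∈ p∈′) }) (unique H)))
    where
    same : ∀ {e e′ p} → p ∈ₗ flags e → p ∈ₗ flags e′ → e ≡ e′
    same {e} {e′} p∈ p∈′ with ∈-map⁻ _ p∈ | ∈-map⁻ _ p∈′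
    ... | x , x∈ , refl | x′ , x′∈ , eq with refl ← cong proj₂ eq = begin
      e                    ≡⟨ p-x∪x (∈-elems⁻ e x∈) ⟨
      (e - x) ∪ ⁅ x ⁆      ≡⟨ cong (_∪ ⁅ x ⁆) (cong proj₁ eq) ⟩
      (e′ - x) ∪ ⁅ x ⁆     ≡⟨ p-x∪x (∈-elems⁻ e′ x′∈) ⟩
      e′                   ∎
      where open ≡-Reasoning

  pairs : List (Subset n × Fin n)
  pairs = concatMap (λ L → map (L ,_) (ext L)) (subsetsOfSize n k)

  flags⊆pairs : ∀ {p} → p ∈ₗ concatMap flags Es → p ∈ₗ pairs
  flags⊆pairs p∈ with find (∈-concatMap⁻ flags {xs = Es} p∈)
  ... | e , e∈ , p∈e with x , x∈ , refl ← ∈-map⁻ _ p∈e =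
    ∈-concatMap⁺ (λ L → map (L ,_) (ext L))
      (lose (∈-subsetsOfSize (e - x) (suc-injective (trans (∣p-x∣ (∈-elems⁻ e x∈)) (∣Es∣ e∈))))
            (∈-map⁺ (e - x ,_) (∈-ext e∈ (∈-elems⁻ e x∈))))

  -- Double counting of flags (L, x): each (r-1)-set L contributes 1/d(L) at most d(L) times, hence
  -- at most one unit `n !`.
  ∑W≤ : ∑ Es W ≤ (n C k) * n !
  ∑W≤ = begin
    ∑ Es W                                                ≤⟨ ∑-mono Es (λ {e} _ → ≤-reflexive (sym (∑-map (λ x → e - x , x) (w ∘ proj₁) (elems e)))) ⟩
    ∑ Es (λ e → ∑ (flags e) (w ∘ proj₁))                  ≡⟨ ∑-concatMap flags (w ∘ proj₁) Es ⟨
    ∑ (concatMap flags Es) (w ∘ proj₁)                    ≤⟨ ∑-unique-⊆ (w ∘ proj₁) flags-unique flags⊆pairs ⟩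
    ∑ pairs (w ∘ proj₁)                                   ≡⟨ ∑-concatMap (λ L → map (L ,_) (ext L)) (w ∘ proj₁) Ls ⟩
    ∑ Ls (λ L → ∑ (map (L ,_) (ext L)) (w ∘ proj₁))       ≤⟨ ∑-mono Ls (λ {L} _ → per-L L) ⟩
    ∑ Ls (λ _ → n !)                                      ≡⟨ ∑-const Ls (n !) ⟩
    length Ls * n !                                       ≡⟨ cong (_* n !) (length-subsetsOfSize n k) ⟩
    (n C k) * n !                                         ∎
    where
    open ≤-Reasoning
    Ls = subsetsOfSize n k
    per-L : ∀ L → ∑ (map (L ,_) (ext L)) (w ∘ proj₁) ≤ n !
    per-L L = ≤-trans (≤-reflexive (trans (∑-map (L ,_) (w ∘ proj₁) (ext L)) (∑-const (ext L) (w L)))) (*-inverse-≤ (codeg L))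

  good? : ∀ e → Dec (t * W e < n !)
  good? e = t * W e <? n !

  G = filter good? Es

  -- Each edge that is not good carries at least `n !` in `t * W e`, and by `∑W≤` these values sum
  -- to at most `t * (n C k) * n !`.
  edges≤ : length Es ≤ t * (n C k) + length G
  edges≤ = *-cancelʳ-≤ (length Es) _ (n !) {{n !≢0}} (begin
    length Es * n !                             ≤⟨ length≤filter+∑ good? (λ e → t * W e) (λ e → ≮⇒≥) Es ⟩
    length G * n ! + ∑ Es (λ e → t * W e)       ≤⟨ +-monoʳ-≤ (length G * n !) (≤-trans (∑-mono Es (λ {e} _ → ≤-reflexive (*-comm t (W e)))) (≤-reflexive (∑-*ʳ Es W t))) ⟩
    length G * n ! + ∑ Es W * t                 ≤⟨ +-monoʳ-≤ (length G * n !) (*-monoˡ-≤ t ∑W≤) ⟩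
    length G * n ! + (n C k) * n ! * t          ≡⟨ solve 4 (λ g p c t → g :* p :+ c :* p :* t := (t :* c :+ g) :* p) refl (length G) (n !) (n C k) t ⟩
    (t * (n C k) + length G) * n !              ∎)
    where
    open ≤-Reasoning
    open +-*-Solver

  G-unique : Unique G
  G-unique = Unique-filter⁺ good? (unique H)

  ∣G∣ : ∀ {e} → e ∈ₗ G → ∣ e ∣ ≡ suc k
  ∣G∣ = ∣Es∣ ∘ proj₁ ∘ ∈-filter⁻ good?

  -- Candidate pendants for the `m` = tr facets of a star

  m = t * suc k

  options : Subset n → Fin n → List (Fin n)
  options e x = filter (λ y → ¬? (y ∈? e)) (ext (e - x))

  -- Only `x` can be lost: every other vertex of `e` lies in `e - x` and so does not extend it.
  codeg≤options : ∀ e x → codeg (e - x) ≤ suc (length (options e x))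
  codeg≤options e x = length-unique-⊆ {ys = x ∷ options e x} (ext-unique (e - x)) ext⊆
    where
    ext⊆ : ∀ {y} → y ∈ₗ ext (e - x) → y ∈ₗ x ∷ options e x
    ext⊆ {y} y∈ with y Fin.≟ x
    ... | yes y≡x = here y≡x
    ... | no  y≢x = there (∈-filter⁺ (λ y → ¬? (y ∈? e)) y∈
                      (λ y∈e → proj₁ (proj₂ (∈-filter⁻ (extends? (e - x)) {xs = allFin n} y∈)) (x∈p∧x≢y⇒x∈p-y y∈e y≢x)))

  -- Truncated so that E e has size bounded independently of n; m options suffice for m facets.
  opts : Subset n → Fin n → List (Fin n)
  opts e x = take m (options e x)

  opts-unique : ∀ e x → Unique (opts e x)
  opts-unique e x = Unique-take⁺ m (Unique-filter⁺ (λ y → ¬? (y ∈? e)) (ext-unique (e - x)))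

  ∈-opts : ∀ {e x y} → y ∈ₗ opts e x → y ∉ e × ((e - x) ∪ ⁅ y ⁆) ∈ₗ Es
  ∈-opts {e} {x} = All.lookup (All-take⁺ m (All.tabulate λ y∈ →
    let (y∈ext , y∉e) = ∈-filter⁻ (λ y → ¬? (y ∈? e)) {xs = ext (e - x)} y∈
        (_ , _ , in-Es) = ∈-filter⁻ (extends? (e - x)) {xs = allFin n} y∈ext
    in y∉e , in-Es))

  opts-enough : ∀ {e x} → e ∈ₗ Es → x ∈ e → m ≤ length (opts e x) ⊎ n ! ≤ w (e - x) * suc (length (opts e x))
  opts-enough {e} {x} e∈ x∈ with m ≤? length (options e x)
  ... | yes m≤ = inj₁ (≤-reflexive (sym (trans (length-take m (options e x)) (m≤n⇒m⊓n≡m m≤))))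
  ... | no  m≰ = inj₂ (begin
    -- The codegree is positive because `x` itself extends `e - x`, so the value of `inverse` at 0
    -- does not occur.
    n !                                         ≡⟨ inverse-* (∈-length (∈-ext e∈ x∈)) (codeg≤n (e - x)) ⟨
    w (e - x) * codeg (e - x)                   ≤⟨ *-monoʳ-≤ (w (e - x)) (codeg≤options e x) ⟩
    w (e - x) * suc (length (options e x))      ≡⟨ cong (λ ys → w (e - x) * suc (length ys)) (take-all m (options e x) (≰⇒≥ m≰)) ⟨
    w (e - x) * suc (length (opts e x))         ∎)
    where
    open ≤-Reasoning

  -- Gathers the options of all r facets of `e`. With at most `m` for each, the bound `M` on its
  -- length depends only on `t` and `k`.
  E : Subset n → List (Fin n)
  E e = concatMap (opts e) (elems e)

  E-disjoint : ∀ e → All (_∉ e) (E e)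
  E-disjoint e = All.tabulate λ y∈ → let (x , _ , y∈x) = find (∈-concatMap⁻ (opts e) {xs = elems e} y∈) in proj₁ (∈-opts y∈x)

  M = suc k * m

  E≤M : ∀ {e} → e ∈ₗ G → length (E e) ≤ M
  E≤M {e} e∈ = ≤-trans (length-concatMap-≤ (opts e) (elems e) {m}
                         (λ {x} _ → ≤-trans (≤-reflexive (length-take m (options e x))) (m⊓n≤m m _)))
                       (≤-reflexive (cong (_* m) (trans (length-elems e) (∣G∣ e∈))))

  module At (v : Fin n) = Star E E-disjoint G ∣G∣ M E≤M v

  -- Embedding F(t,r) into a separated star of good edges

  module Embed (v : Fin n) (e : Fin t → Subset n) (e∈G : ∀ i → e i ∈ₗ G × v ∈ e i)
               (separated : ∀ i j → i ≢ j → At.Separated v (e i) (e j)) where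

    e∈Es : ∀ i → e i ∈ₗ Es
    e∈Es i = proj₁ (∈-filter⁻ good? (proj₁ (e∈G i)))

    enum = λ i → enumerate (e i) (proj₂ (e∈G i)) (∣G∣ (proj₁ (e∈G i)))

    φ : Fin t → Fin (suc k) → Fin n
    φ i = proj₁ (enum i)

    φ-zero : ∀ i → φ i zero ≡ v
    φ-zero i = proj₁ (proj₂ (enum i))

    φ-injective : ∀ i → Injective _≡_ _≡_ (φ i)
    φ-injective i = proj₁ (proj₂ (proj₂ (enum i)))

    φ∈e : ∀ i j → φ i j ∈ e i
    φ∈e i = proj₁ (proj₂ (proj₂ (proj₂ (enum i))))

    φ-onto : ∀ i {x} → x ∈ e i → ∃[ j ] φ i j ≡ x
    φ-onto i = proj₂ (proj₂ (proj₂ (proj₂ (enum i))))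

    tasks : List (Fin t × Fin (suc k))
    tasks = concatMap (λ i → map (i ,_) (allFin (suc k))) (allFin t)

    ∈-tasks : ∀ a → a ∈ₗ tasks
    ∈-tasks (i , j) = ∈-concatMap⁺ (λ i → map (i ,_) (allFin (suc k))) (lose (∈-allFin i) (∈-map⁺ (i ,_) (∈-allFin j)))

    length-tasks : length tasks ≤ m
    length-tasks = ≤-trans
      (length-concatMap-≤ (λ i → map (i ,_) (allFin (suc k))) (allFin t)
        (λ {i} _ → ≤-reflexive (trans (length-map (i ,_) (allFin (suc k))) (length-tabulate {n = suc k} (λ j → j)))))
      (≤-reflexive (cong (_* suc k) (length-tabulate {n = t} (λ i → i))))

    ω : Fin t × Fin (suc k) → ℕ
    ω (i , j) = w (e i - φ i j)

    -- Goodness gives `W (e i) * t < n !` for each of the `t` edges. Adding these strict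
    -- inequalities gains `t`, which is exactly what `t * suc (∑ tasks ω)` needs before `t` is
    -- cancelled.
    ∑ω<n! : ∑ tasks ω < n !
    ∑ω<n! = *-cancelˡ-≤ t {{>-nonZero 0<t}} (begin
      t * suc (∑ tasks ω)                        ≡⟨ *-suc t (∑ tasks ω) ⟩
      t + t * ∑ tasks ω                          ≤⟨ +-monoʳ-≤ t (*-monoʳ-≤ t ∑ω≤) ⟩
      t + t * ∑ (allFin t) (W ∘ e)               ≡⟨ cong₂ _+_ (sym (length-tabulate {n = t} (λ i → i))) (trans (*-comm t _) (sym (∑-*ʳ (allFin t) (W ∘ e) t))) ⟩
      length (allFin t) + ∑ (allFin t) (λ i → W (e i) * t)  ≤⟨ length+∑≤ (allFin t) (λ i → W (e i) * t) (λ i → subst (_< n !) (*-comm t (W (e i))) (proj₂ (∈-filter⁻ good? {xs = Es} (proj₁ (e∈G i))))) ⟩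
      length (allFin t) * n !                    ≡⟨ cong (_* n !) (length-tabulate {n = t} (λ i → i)) ⟩
      t * n !                                    ∎)
      where
      open ≤-Reasoning
      per-i : ∀ i → ∑ (map (i ,_) (allFin (suc k))) ω ≤ W (e i)
      per-i i = begin
        ∑ (map (i ,_) (allFin (suc k))) ω                      ≡⟨ ∑-map (i ,_) ω (allFin (suc k)) ⟩
        ∑ (allFin (suc k)) (λ j → w (e i - φ i j))             ≡⟨ ∑-map (φ i) (λ x → w (e i - x)) (allFin (suc k)) ⟨
        ∑ (map (φ i) (allFin (suc k))) (λ x → w (e i - x))     ≤⟨ ∑-unique-⊆ (λ x → w (e i - x)) (Unique-map⁺ (φ-injective i) (allFin⁺ (suc k)))
                                                                   (λ x∈ → let (j , _ , eq) = ∈-map⁻ (φ i) x∈ in ∈-elems⁺ (subst (_∈ e i) (sym eq) (φ∈e i j))) ⟩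
        W (e i)                                                ∎
      ∑ω≤ : ∑ tasks ω ≤ ∑ (allFin t) (W ∘ e)
      ∑ω≤ = ≤-trans (≤-reflexive (∑-concatMap (λ i → map (i ,_) (allFin (suc k))) ω (allFin t))) (∑-mono (allFin t) (λ {i} _ → per-i i))

    opt : Fin t × Fin (suc k) → List (Fin n)
    opt (i , j) = opts (e i) (φ i j)

    open SDR (×-≡-dec Fin._≟_ Fin._≟_) Fin._≟_ v opt (λ (i , j) → opts-unique (e i) (φ i j)) ω (n !) m

    enough : ∀ a → Enough a
    enough (i , j) = opts-enough {e i} {φ i j} (e∈Es i) (φ∈e i j)

    abstract
      representatives : ∃[ g ] Represents tasks g
      representatives = sdr (length tasks) tasks refl length-tasks (λ {a} _ → enough a) ∑ω<n!

    p : Fin t × Fin (suc k) → Fin n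
    p = proj₁ representatives

    p∈ : ∀ a → p a ∈ₗ opt a
    p∈ a = proj₁ (proj₂ representatives) (∈-tasks a)

    p-injective : ∀ {a b} → p a ≡ p b → a ≡ b
    p-injective {a} {b} = proj₂ (proj₂ representatives) (∈-tasks a) (∈-tasks b)

    p-opts : ∀ i j → p (i , j) ∉ e i × ((e i - φ i j) ∪ ⁅ p (i , j) ⁆) ∈ₗ Es
    p-opts i j = ∈-opts {e i} {φ i j} (p∈ (i , j))

    -- On its own edge a pendant is excluded by the choice of options; on the other edges by
    -- `Separated`, since it belongs to `E (e i)`.
    p∉ : ∀ i j i′ → p (i , j) ∉ e i′
    p∉ i j i′ with i Fin.≟ i′
    ... | yes refl = proj₁ (p-opts i j)
    ... | no  i≢i′ = All.lookup (proj₁ (proj₂ (separated i i′ i≢i′)))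
                       (∈-concatMap⁺ (opts (e i)) {xs = elems (e i)} (lose {x = φ i j} (∈-elems⁺ (φ∈e i j)) (p∈ (i , j))))

    f : FVert t k → Fin n
    f center     = v
    f (core i a) = φ i (suc a)
    f (pend i j) = p (i , j)

    f-copyVert : ∀ i a → f (copyVert i a) ≡ φ i a
    f-copyVert i zero    = sym (φ-zero i)
    f-copyVert i (suc a) = refl

    v≢core : ∀ i a → v ≢ φ i (suc a)
    v≢core i a eq with () ← φ-injective i (trans (φ-zero i) eq)

    f-injective : Injective _≡_ _≡_ f
    f-injective {center}   {center}     eq = refl
    f-injective {center}   {core i a}   eq = contradiction eq (v≢core i a)
    f-injective {center}   {pend i j}   eq = contradiction (subst (_∈ e i) eq (proj₂ (e∈G i))) (p∉ i j i)
    f-injective {core i a} {center}     eq = contradiction (sym eq) (v≢core i a)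
    f-injective {core i a} {core i′ b}  eq with i Fin.≟ i′
    ... | yes refl with refl ← φ-injective i eq = refl
    -- A vertex common to two different edges of the star is `v`, which is no core vertex.
    ... | no  i≢i′ = contradiction (sym (proj₁ (separated i i′ i≢i′) (φ∈e i (suc a)) (subst (_∈ e i′) (sym eq) (φ∈e i′ (suc b))))) (v≢core i a)
    f-injective {core i a} {pend i′ j}  eq = contradiction (subst (_∈ e i) eq (φ∈e i (suc a))) (p∉ i′ j i)
    f-injective {pend i j} {center}     eq = contradiction (subst (_∈ e i) (sym eq) (proj₂ (e∈G i))) (p∉ i j i)
    f-injective {pend i j} {core i′ a}  eq = contradiction (subst (_∈ e i′) (sym eq) (φ∈e i′ (suc a))) (p∉ i j i′)
    f-injective {pend i j} {pend i′ j′} eq with refl ← p-injective eq = refl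

    containsF : ContainsF t k H
    containsF = f , f-injective , λ i j → (e i - φ i j) ∪ ⁅ p (i , j) ⁆ , proj₂ (p-opts i j) , λ x → mk⇔ (to i j) (from i j)
      where
      to : ∀ i j {x} → x ∈ (e i - φ i j) ∪ ⁅ p (i , j) ⁆ → ∃[ u ] (InFEdge i j u × f u ≡ x)
      to i j x∈ with x∈p∪q⁻ (e i - φ i j) ⁅ p (i , j) ⁆ x∈
      ... | inj₂ x∈p = pend i j , inj₁ refl , sym (x∈⁅y⁆⇒x≡y _ x∈p)
      ... | inj₁ x∈L with a , refl ← φ-onto i (x∈p-y⇒x∈p {p = e i} x∈L) =
        copyVert i a , inj₂ (a , (λ { refl → x∉p-x (e i) _ x∈L }) , refl) , f-copyVert i a
      from : ∀ i j {x} → ∃[ u ] (InFEdge i j u × f u ≡ x) → x ∈ (e i - φ i j) ∪ ⁅ p (i , j) ⁆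
      from i j (_ , inj₁ refl , refl) = x∈p∪q⁺ (inj₂ (x∈⁅x⁆ _))
      from i j (_ , inj₂ (a , a≢j , refl) , refl) = x∈p∪q⁺ (inj₁ (subst (_∈ e i - φ i j) (sym (f-copyVert i a))
        (x∈p∧x≢y⇒x∈p-y (φ∈e i a) (a≢j ∘ φ-injective i))))

  -- In `separate` each chosen edge uses up itself and at most `M` others, so `s` edges leave `t`
  -- separated ones. `B` is the resulting bound on a blocking set from `grow`.
  s = t * suc M
  B = s * (k + M)

  -- A star of `s` edges at `v` would yield `t` separated good edges and hence F(t,r), so only the
  -- blocking alternative of `grow` is left.
  blocker : ¬ ContainsF t k H → ∀ v →
            ∃[ X ] (length X ≤ B × v ∉ₗ X × (∀ {e} → e ∈ₗ G → v ∈ e → ∃[ u ] (u ∈ₗ X × u ∈ e)))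
  blocker F-free v with At.grow v s
  ... | inj₂ X = X
  ... | inj₁ (es , len , es∈ , avoid)
    with es′ , len′ , es∈′ , sep ← At.separate v t es {_∈ₗ G} (λ e∈ → e∈) (≤-reflexive (sym len)) es∈ avoid
    with e , e∈ , e-sep ← index-pairs (At.separated-sym v) es′ len′ es∈′ sep
    = contradiction (Embed.containsF v e e∈ e-sep) F-free

-- Here k = 2 + j.
upperConstant : ℕ → ℕ → ℕ
upperConstant t j = suc j * B * (suc (suc j) * B)
  where
  M = (3 + j) * (t * (3 + j))
  B = t * suc M * ((2 + j) + M)

-- `edges≤` accounts for the edges that are not good. The good ones are closed under the blocking
-- sets `X v`, so `closed-count` applies with `B` as the bound on the out-degree.
upper : ∀ {n j t} → 0 < t → (H : Hypergraph (3 + j) n) → ¬ ContainsF t (2 + j) H →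
        numEdges H ≤ t * (n C (2 + j)) + upperConstant t j * n ^ suc j
upper {n} {j} {t} 0<t H F-free = ≤-trans edges≤ (+-monoʳ-≤ (t * (n C (2 + j))) (closed-count G-unique
    λ e∈ → ∣G∣ e∈ , λ {v} v∈ → proj₂ (proj₂ (proj₂ (blocker F-free v))) e∈ v∈))
  where
  open UpperBound t 0<t H
  open Closed (λ v → proj₁ (blocker F-free v)) (λ v → proj₁ (proj₂ (proj₂ (blocker F-free v)))) B (λ v → proj₁ (proj₂ (blocker F-free v)))

-- The extremal construction

∣++∣ : ∀ {a b} (p : Subset a) (q : Subset b) → ∣ p ++ᵛ q ∣ ≡ ∣ p ∣ + ∣ q ∣
∣++∣ []            q = refl
∣++∣ (inside  ∷ p) q = cong suc (∣++∣ p q)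
∣++∣ (outside ∷ p) q = ∣++∣ p q

∈-++ˡ⁺ : ∀ {a b} {p : Subset a} {q : Subset b} {x} → x ∈ p → x ↑ˡ b ∈ p ++ᵛ q
∈-++ˡ⁺ here       = here
∈-++ˡ⁺ (there x∈) = there (∈-++ˡ⁺ x∈)

∈-++ˡ⁻ : ∀ {a b} (p : Subset a) {q : Subset b} {x} → x ↑ˡ b ∈ p ++ᵛ q → x ∈ p
∈-++ˡ⁻ (_ ∷ p) {x = zero}  here       = here
∈-++ˡ⁻ (_ ∷ p) {x = suc x} (there x∈) = there (∈-++ˡ⁻ p x∈)

⁅⁆-injective : ∀ {n} {x y : Fin n} → ⁅ x ⁆ ≡ ⁅ y ⁆ → x ≡ y
⁅⁆-injective {x = x} {y} eq = x∈⁅y⁆⇒x≡y y (subst (x ∈_) eq (x∈⁅x⁆ x))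

length-cartesianProductWith : {A B C : Set} (f : A → B → C) → ∀ xs ys →
                              length (cartesianProductWith f xs ys) ≡ length xs * length ys
length-cartesianProductWith f []       ys = refl
length-cartesianProductWith f (x ∷ xs) ys =
  trans (length-++ (map (f x) ys)) (cong₂ _+_ (length-map (f x) ys) (length-cartesianProductWith f xs ys))

-- The set T consists of the first `t` of the `t + o` vertices, that is, those of the form `x ↑ˡ o`.
-- Concatenating a singleton with a k-subset of the rest makes the edge count a product.
crosscut : ∀ t o k → Hypergraph (suc k) (t + o)
crosscut t o k = record
  { edges   = cartesianProductWith join (allFin t) (subsetsOfSize o k)
  ; unique  = Unique-cartesianProductWith⁺ join join-injective (allFin⁺ t) (subsetsOfSize-unique o k)
  ; uniform = All.tabulate size
  }
  where
  join : Fin t → Subset o → Subset (t + o)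
  join i L = ⁅ i ⁆ ++ᵛ L
  join-injective : ∀ {i j L K} → join i L ≡ join j K → i ≡ j × L ≡ K
  join-injective {i} {j} eq with eq₁ , eq₂ ← ++-injective ⁅ i ⁆ ⁅ j ⁆ eq = ⁅⁆-injective eq₁ , eq₂
  size : ∀ {e} → e ∈ₗ cartesianProductWith join (allFin t) (subsetsOfSize o k) → ∣ e ∣ ≡ suc k
  size e∈ with i , L , _ , L∈ , refl ← ∈-cartesianProductWith⁻ join (allFin t) (subsetsOfSize o k) e∈ =
    trans (∣++∣ ⁅ i ⁆ L) (cong₂ _+_ (∣⁅x⁆∣≡1 i) (All.lookup (size-subsetsOfSize o k) L∈))

numEdges-crosscut : ∀ t o k → numEdges (crosscut t o k) ≡ t * (o C k)
numEdges-crosscut t o k = trans (length-cartesianProductWith _ (allFin t) (subsetsOfSize o k))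
  (cong₂ _*_ (length-tabulate {n = t} (λ i → i)) (length-subsetsOfSize o k))

∈-crosscut : ∀ {t o k e} → e ∈ₗ edges (crosscut t o k) →
             ∃[ x ] (x ↑ˡ o ∈ e × (∀ {y} → y ↑ˡ o ∈ e → y ≡ x))
∈-crosscut {t} {o} {k} e∈ with i , L , _ , _ , refl ← ∈-cartesianProductWith⁻ _ (allFin t) (subsetsOfSize o k) e∈ =
  i , ∈-++ˡ⁺ (x∈⁅x⁆ i) , λ y∈ → x∈⁅y⁆⇒x≡y i (∈-++ˡ⁻ ⁅ i ⁆ y∈)

-- Absence of F(t,r) from the construction

module CrosscutFree {t o j : ℕ} (F : ContainsF t (2 + j) (crosscut t o (2 + j))) where

  private
    k = 2 + j

  f = proj₁ F
  f-injective = proj₁ (proj₂ F)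

  -- Says that the image of `u` lies in T.
  Marked : FVert t k → Set
  Marked u = ∃[ x ] (x ↑ˡ o ≡ f u)

  mark : ∀ i a → ∃[ u ] (InFEdge i a u × Marked u)
  mark i a with e , e∈ , iff ← proj₂ (proj₂ F) i a with x , x∈ , _ ← ∈-crosscut {t} {o} {k} e∈
    with u , u∈ , fu≡ ← Equivalence.to (iff _) x∈ = u , u∈ , x , sym fu≡

  mark-unique : ∀ i a {u u′} → InFEdge i a u → InFEdge i a u′ → Marked u → Marked u′ → u ≡ u′
  mark-unique i a {u} {u′} u∈ u′∈ (y , eq) (y′ , eq′)
    with e , e∈ , iff ← proj₂ (proj₂ F) i a with x , x∈ , only ← ∈-crosscut {t} {o} {k} e∈ =
    f-injective (trans (sym eq) (trans (cong (_↑ˡ o) (trans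
      (only (subst (_∈ e) (sym eq) (Equivalence.from (iff _) (u , u∈ , refl))))
      (sym (only (subst (_∈ e) (sym eq′) (Equivalence.from (iff _) (u′ , u′∈ , refl))))))) eq′))

  -- Distinct marked vertices have distinct images in T, which has only `t` elements.
  too-many : (g : Fin (suc t) → FVert t k) → (∀ i → Marked (g i)) → ¬ Injective _≡_ _≡_ g
  too-many g marked g-inj with i , i′ , i<i′ , eq ← Fin.pigeonhole ≤-refl (proj₁ ∘ marked) =
    Fin.<⇒≢ i<i′ (g-inj (f-injective (trans (sym (proj₂ (marked i))) (trans (cong (_↑ˡ o) eq) (proj₂ (marked i′))))))

  -- Hyperedge `b` then omits neither the center nor core vertex `a`. Such an index exists because
  -- there are r ≥ 3 of them.
  third : (a : Fin k) → ∃[ b ] (b ≢ zero × b ≢ suc a)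
  third zero    = suc (suc zero) , (λ ()) , λ ()
  third (suc a) = suc zero , (λ ()) , λ ()

  -- Hyperedge zero omits the center, so its marked vertex is a core vertex or the pendant. A marked
  -- core vertex would share some hyperedge with the marked center, against `mark-unique`.
  pend-marked : Marked center → ∀ i → Marked (pend i zero)
  pend-marked c i with mark i zero
  ... | _ , inj₁ refl , m = m
  ... | _ , inj₂ (zero  , a≢0 , _) , _ = contradiction refl a≢0
  ... | _ , inj₂ (suc a , _ , refl) , m with b , b≢0 , b≢a ← third a =
    contradiction (mark-unique i b (inj₂ (zero , b≢0 ∘ sym , refl)) (inj₂ (suc a , b≢a ∘ sym , refl)) c m) λ ()

  InCopy : Fin t → FVert t k → Set
  InCopy i u = (∃[ a ] u ≡ core i a) ⊎ (∃[ a ] u ≡ pend i a)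

  inCopy-injective : ∀ {i i′ u} → InCopy i u → InCopy i′ u → i ≡ i′
  inCopy-injective (inj₁ (_ , refl)) (inj₁ (_ , refl)) = refl
  inCopy-injective (inj₂ (_ , refl)) (inj₂ (_ , refl)) = refl

  inCopy : ¬ Marked center → ∀ {i a u} → InFEdge i a u → Marked u → InCopy i u
  inCopy ¬c (inj₁ refl)              m = inj₂ (_ , refl)
  inCopy ¬c (inj₂ (zero , _ , refl))  m = contradiction m ¬c
  inCopy ¬c (inj₂ (suc a , _ , refl)) m = inj₁ (a , refl)

  -- A core vertex is missed by the hyperedge that omits it, and a pendant by every hyperedge other
  -- than its own.
  avoided : ∀ {i u} → InCopy i u → ∃[ a ] ¬ InFEdge i a u
  avoided (inj₁ (a , refl)) = suc a , λ { (inj₂ (zero , _ , ())) ; (inj₂ (suc b , b≢a , refl)) → b≢a refl }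
  avoided (inj₂ (zero , refl)) = suc zero , λ { (inj₂ (zero , _ , ())) ; (inj₂ (suc b , _ , ())) }
  avoided (inj₂ (suc a , refl)) = zero , λ { (inj₂ (zero , _ , ())) ; (inj₂ (suc b , _ , ())) }

  -- The center and the pendants `pend i zero` of the `t` copies would be `t + 1` marked vertices.
  center-unmarked : ¬ Marked center
  center-unmarked c = too-many g marked inj
    where
    g : Fin (suc t) → FVert t k
    g zero    = center
    g (suc i) = pend i zero
    marked : ∀ i → Marked (g i)
    marked zero    = c
    marked (suc i) = pend-marked c i
    inj : Injective _≡_ _≡_ g
    inj {zero}  {zero}  _    = refl
    inj {suc _} {suc _} refl = refl

  -- With the center unmarked, each of the `t` copies has a marked vertex of its own, and copy `i₀`
  -- has a second one.
  center-marked : Fin t → ¬ ¬ Marked center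
  center-marked i₀ ¬c = too-many g marked inj
    where
    first : ∀ i → InCopy i (proj₁ (mark i zero))
    first i = inCopy ¬c (proj₁ (proj₂ (mark i zero))) (proj₂ (proj₂ (mark i zero)))
    -- This hyperedge of copy `i₀` misses the marked vertex already found there, so its own marked
    -- vertex is a new one.
    a = proj₁ (avoided (first i₀))
    second = mark i₀ a
    g : Fin (suc t) → FVert t k
    g zero    = proj₁ second
    g (suc i) = proj₁ (mark i zero)
    marked : ∀ i → Marked (g i)
    marked zero    = proj₂ (proj₂ second)
    marked (suc i) = proj₂ (proj₂ (mark i zero))
    second≢ : ∀ i → proj₁ second ≢ proj₁ (mark i zero)
    second≢ i eq with refl ← inCopy-injective (subst (InCopy i₀) eq (inCopy ¬c (proj₁ (proj₂ second)) (proj₂ (proj₂ second)))) (first i) =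
      proj₂ (avoided (first i₀)) (subst (InFEdge i₀ a) eq (proj₁ (proj₂ second)))
    inj : Injective _≡_ _≡_ g
    inj {zero}  {zero}  _  = refl
    inj {zero}  {suc i} eq = contradiction eq (second≢ i)
    inj {suc i} {zero}  eq = contradiction (sym eq) (second≢ i)
    inj {suc i} {suc j} eq = cong suc (inCopy-injective (first i) (subst (InCopy j) (sym eq) (first j)))

crosscut-free : ∀ {t o j} → 0 < t → ¬ ContainsF t (2 + j) (crosscut t o (2 + j))
crosscut-free 0<t F = center-marked (fromℕ< 0<t) center-unmarked
  where open CrosscutFree F

-- Binomial estimates and the two bounds combined

nCk≤n^k : ∀ n k → n C k ≤ n ^ k
nCk≤n^k n       zero    = ≤-reflexive (nC0≡1 n)
nCk≤n^k zero    (suc k) = z≤n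
nCk≤n^k (suc n) (suc k) = begin
  suc n C suc k             ≡⟨ nCk+nC[k+1]≡[n+1]C[k+1] n k ⟨
  n C k + n C suc k         ≤⟨ +-mono-≤ (nCk≤n^k n k) (nCk≤n^k n (suc k)) ⟩
  n ^ k + n * n ^ k         ≤⟨ *-monoʳ-≤ (suc n) (^-monoˡ-≤ k (n≤1+n n)) ⟩
  suc n * suc n ^ k         ∎
  where open ≤-Reasoning

-- By Pascal's rule each of the `t` removed vertices costs one binomial coefficient of lower index
-- `k`, at most `(t + o) ^ k`. Deleting T thus changes the count only in the error term.
[t+o]Ck≤ : ∀ t o k → (t + o) C suc k ≤ o C suc k + t * (t + o) ^ k
[t+o]Ck≤ zero    o k = ≤-reflexive (sym (+-identityʳ _))
[t+o]Ck≤ (suc t) o k = begin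
  suc (t + o) C suc k                                          ≡⟨ nCk+nC[k+1]≡[n+1]C[k+1] (t + o) k ⟨
  (t + o) C k + (t + o) C suc k                                ≤⟨ +-mono-≤ (nCk≤n^k (t + o) k) ([t+o]Ck≤ t o k) ⟩
  (t + o) ^ k + (o C suc k + t * (t + o) ^ k)                  ≡⟨ x∙yz≈y∙xz ((t + o) ^ k) (o C suc k) (t * (t + o) ^ k) ⟩
  o C suc k + suc t * (t + o) ^ k                              ≤⟨ +-monoʳ-≤ (o C suc k) (*-monoʳ-≤ (suc t) (^-monoˡ-≤ k (n≤1+n (t + o)))) ⟩
  o C suc k + suc t * suc (t + o) ^ k                          ∎
  where open ≤-Reasoning

-- In `t * t` one factor counts the vertices of T lost from the binomial coefficient; the other is
-- the factor `t` in front of it.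
lower : ∀ {n j t} → 0 < t → t ≤ n → Σ (Hypergraph (3 + j) n) λ H →
        ¬ ContainsF t (2 + j) H × t * (n C (2 + j)) ≤ numEdges H + (t * t) * n ^ suc j
lower {n} {j} {t} 0<t t≤n with o , refl ← m≤n⇒∃[o]m+o≡n t≤n = crosscut t o (2 + j) , crosscut-free 0<t , (begin
  t * ((t + o) C (2 + j))                                      ≤⟨ *-monoʳ-≤ t ([t+o]Ck≤ t o (suc j)) ⟩
  t * (o C (2 + j) + t * (t + o) ^ suc j)                      ≡⟨ *-distribˡ-+ t (o C (2 + j)) _ ⟩
  t * (o C (2 + j)) + t * (t * (t + o) ^ suc j)                ≡⟨ cong₂ _+_ (sym (numEdges-crosscut t o (2 + j))) (sym (*-assoc t t _)) ⟩
  numEdges (crosscut t o (2 + j)) + t * t * (t + o) ^ suc j    ∎)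
  where open ≤-Reasoning

theorem2 : (k t : ℕ) → 3 ≤ suc k → 1 < t →
    ∃[ c ] ∃[ N ] ((n : ℕ) → N ≤ n →
    (((H : Hypergraph (suc k) n) → ¬ ContainsF t k H →
    numEdges H ≤ t * (n C k) + c * n ^ (k ∸ 1))
    × (Σ (Hypergraph (suc k) n) λ H → (¬ ContainsF t k H ×
    t * (n C k) ≤ numEdges H + c * n ^ (k ∸ 1)))))
-- The threshold `N` is `t`, so that T fits into the vertex set; the sum of the two constants serves
-- both bounds.
theorem2 (suc (suc j)) t (s≤s (s≤s (s≤s _))) 1<t = c₁ + t * t , t , λ n t≤n →
    (λ H F-free → ≤-trans (upper 0<t H F-free)
                          (+-monoʳ-≤ (t * (n C (2 + j))) (*-monoˡ-≤ (n ^ suc j) (m≤m+n c₁ (t * t)))))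
  , (let (H , F-free , bound) = lower {j = j} 0<t t≤n in
     H , F-free , ≤-trans bound (+-monoʳ-≤ (numEdges H) (*-monoˡ-≤ (n ^ suc j) (m≤n+m (t * t) c₁))))
  where
  c₁ = upperConstant t j
  0<t = <⇒≤ 1<t
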